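{- Let $\mathbb{N}$ denote the natural numbers. For each $i\in\{1,2,3,4\}$ and each $j\in\mathbb{N}$ let $S_{ij}\subseteq\mathbb{N}$ be a set with $|S_{ij}|=4$. Then there exist $a_{ij}\in\mathbb{N}$ ($i\in\{1,2,3,4\}$, $j\in\mathbb{N}$) such that the following hold: (1) $a_{ij}\in S_{ij}$ for all $i\in\{1,2,3,4\}$ and $j\in\mathbb{N}$; (2) for every $i\in\{1,2,3,4\}$: (a) $a_{i1},a_{i2},a_{i3}$ are mutually distinct, and (b) $a_{ij}\notin\{a_{i1},a_{i2}\}$ for all $j\geq 3$; (3) for all $r_1,r_2\in\{1,2,3,4\}$ with $r_1\neq r_2$ and all $j\in\mathbb{N}$, \[\{a_{r_1 1},a_{r_1 2},\ldots,a_{r_1 j}\}\neq\{a_{r_2 1},a_{r_2 2},\ldots,a_{r_2 j}\}.\]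
   Context: This is the case $n=3$, $k=4$ of the following general problem: given $n,k\in\mathbb{N}$ and sets $S_{ij}\subseteq\mathbb{N}$ with $|S_{ij}|=k$ for $i=1,\ldots,k$, $j\in\mathbb{N}$, find $a_{ij}\in S_{ij}$ such that in each row $a_{i1},\ldots,a_{in}$ are mutually distinct, $a_{ij}\notin\{a_{i1},\ldots,a_{i,n-1}\}$ for all $j\ge n$, and for distinct rows $r_1\neq r_2$ the sets of the first $j$ entries differ for every $j\in\mathbb{N}$. -}

module Defs where

open import Data.Nat using (ℕ; suc)
open import Data.List using (List; applyUpTo)

-- Index convention: rows i ∈ {1,2,3,4} are Fin 4; columns j ∈ {1,2,...}
-- are represented 0-based by j ∈ ℕ (column j+1 of the paper is index j).

prefix : (ℕ → ℕ) → ℕ → List ℕ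
prefix f j = applyUpTo f (suc j)

{-# OPTIONS --safe #-}
-- From the third column on, a row may avoid one further value w besides its first two, since |S i j| = 4.
-- So it suffices to find an invariant of the rows' value sets A₁, …, A₄ that keeps them distinct and that
-- survives the extension of any single row by any value other than a suitable w. It has three forms:
--   Guarded:  row r never takes the value f r, and for r ≠ s one of f r ∈ A s, f s ∈ A r holds. This persists.
--   Disjoint: the A r are pairwise disjoint with at least two elements each.
--   Matched:  the rows fall into two pairs, A r and A s are disjoint unless r and s are paired, each row is
--             incomparable to its partner, and some value is common to two partners.
-- When a value of another row enters a Disjoint position, these two rows become partners; when a value
-- crosses between the two pairs of a Matched position, the position becomes Guarded.
-- The first column is any system of distinct representatives e; the second is chosen to reach the invariant.
module Submission where

open import Defs
open import Data.Nat using (ℕ; zero; suc; _+_; _≤_; _<_; s≤s; s≤s⁻¹; z≤n)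
import Data.Nat.Properties as ℕ
open import Data.Fin using (Fin; zero; suc; punchIn; punchOut)
open import Data.Fin.Patterns using (0F; 1F; 2F; 3F)
open import Data.Fin.Properties as Fin using (any?; all?)
open import Data.List using (List; []; _∷_; _++_; length; map; filter; tabulate; allFin)
open import Data.List.Properties using (filter-notAll; length-tabulate)
open import Data.List.Membership.Propositional using (_∈_; _∉_)
open import Data.List.Membership.Propositional.Properties
  using (∈-filter⁺; ∈-map⁺; ∈-map⁻; ∈-allFin; ∈-++⁺ˡ; ∈-++⁺ʳ; ∈-++⁻; ∈-tabulate⁺; ∈-tabulate⁻;
    ∈-applyUpTo⁺; ∈-applyUpTo⁻)
open import Data.List.Relation.Unary.Unique.Propositional.Properties using (allFin⁺)
open import Data.List.Relation.Unary.Unique.DecPropositional (Fin._≟_ {4}) using (unique?)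
import Data.List.Membership.DecPropositional as DecMembership
open import Data.List.Relation.Unary.Any as Any using (Any; here; there)
open import Data.List.Relation.Unary.All as All using (All; []; _∷_)
open import Data.List.Relation.Unary.All.Properties using (¬Any⇒All¬)
open import Data.List.Relation.Unary.AllPairs using (AllPairs; []; _∷_)
open import Data.List.Relation.Unary.Unique.Propositional using (Unique)
open import Data.List.Relation.Binary.BagAndSetEquality using (_∼[_]_; set)
open import Data.Product using (Σ; Σ-syntax; ∃-syntax; ∃₂; _×_; _,_; proj₁; proj₂)
open import Data.Product.Properties using (≡-dec)
open import Data.Sum using (_⊎_; inj₁; inj₂; [_,_]′; swap)
open import Data.Vec using (lookup; []; _∷_)
open import Function using (_∘_; id; Equivalence)
open import Relation.Binary.Definitions using (DecidableEquality; Symmetric)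
open import Relation.Binary.PropositionalEquality
  using (_≡_; _≢_; refl; sym; trans; cong; subst; ≢-sym)
open import Relation.Nullary.Decidable using (from-yes)
open import Relation.Nullary using (¬_; Dec; ¬?; yes; no; contradiction; _×-dec_; _⊎-dec_)

private variable
  A : Set
  n : ℕ

-- Avoiding finite lists, and distinct representatives.

module _ (_≟_ : DecidableEquality A) where
  open DecMembership _≟_ using (_∈?_)

  -- Pigeonhole by induction on `xs`: if the head x occurs in `ys`, deleting x there shortens `ys`,
  -- and nothing is lost because x does not recur in the tail.
  pick : ∀ {xs} (ys : List A) → Unique xs → length ys < length xs →
         ∃[ x ] x ∈ xs × x ∉ ys
  pick {x ∷ xs} ys (x∉xs ∷ xs!) ∣ys∣<∣xs∣ with x ∈? ys
  ... | no x∉ys = x , here refl , x∉ys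
  ... | yes x∈ys =
    let ys─x = filter (¬? ∘ (x ≟_)) ys
        z , z∈xs , z∉ys─x = pick ys─x xs! (ℕ.<-≤-trans
          (filter-notAll (¬? ∘ (x ≟_)) ys (Any.map (λ eq x≢ → x≢ eq) x∈ys))
          (s≤s⁻¹ ∣ys∣<∣xs∣))
    in z , there z∈xs , λ z∈ys →
       z∉ys─x (∈-filter⁺ (¬? ∘ (x ≟_)) z∈ys (All.lookup x∉xs z∈xs))

  -- Greedy choice: list zero is served last and has more elements than there are representatives to
  -- avoid.
  distinctChoice : ∀ (T : Fin n → List A) → (∀ i → Unique (T i)) → (∀ i → n ≤ length (T i)) →
    Σ[ e ∈ (Fin n → A) ] (∀ i → e i ∈ T i) × (∀ {i j} → e i ≡ e j → i ≡ j)
  distinctChoice {zero}  T T! n≤∣T∣ = (λ ()) , (λ ()) , λ {}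
  distinctChoice {suc n} T T! n≤∣T∣
    with e , e∈ , e-injective ← distinctChoice (T ∘ suc) (T! ∘ suc) (ℕ.<⇒≤ ∘ n≤∣T∣ ∘ suc)
    with v , v∈ , v∉ ← pick (tabulate e) (T! zero)
           (ℕ.≤-trans (s≤s (ℕ.≤-reflexive (length-tabulate e))) (n≤∣T∣ zero))
    = e′ , (λ { zero → v∈ ; (suc i) → e∈ i }) , e′-injective
    where
    e′ : Fin (suc n) → A
    e′ zero    = v
    e′ (suc i) = e i
    e′-injective : ∀ {i j} → e′ i ≡ e′ j → i ≡ j
    e′-injective {zero}  {zero}  _  = refl
    e′-injective {zero}  {suc j} eq = contradiction (subst (_∈ _) (sym eq) (∈-tabulate⁺ j)) v∉
    e′-injective {suc i} {zero}  eq = contradiction (subst (_∈ _) eq (∈-tabulate⁺ i)) v∉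
    e′-injective {suc i} {suc j} eq = cong suc (e-injective eq)

-- A missing r could be put in front of `xs`, giving n + 1 distinct elements of `Fin n`. Used to
-- split an arbitrary row into four named cases.
Unique⇒∈ : {xs : List (Fin n)} → Unique xs → length xs ≡ n → ∀ r → r ∈ xs
Unique⇒∈ {n} {xs} xs! ∣xs∣≡n r with DecMembership._∈?_ Fin._≟_ r xs
... | yes r∈xs = r∈xs
... | no  r∉xs =
  let z , _ , z∉ = pick Fin._≟_ (allFin n) (¬Any⇒All¬ xs r∉xs ∷ xs!)
        (s≤s (ℕ.≤-reflexive (trans (length-tabulate {n = n} id) (sym ∣xs∣≡n))))
  in contradiction (∈-allFin z) z∉

AllPairs-lookup : {R : A → A → Set} → Symmetric R → ∀ {x y xs} → AllPairs R xs →
                  x ∈ xs → y ∈ xs → x ≢ y → R x y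
AllPairs-lookup R-sym (_ ∷ _)  (here refl)  (here refl)  x≢y = contradiction refl x≢y
AllPairs-lookup R-sym (r ∷ _)  (here refl)  (there y∈)   x≢y = All.lookup r y∈
AllPairs-lookup R-sym (r ∷ _)  (there x∈)   (here refl)  x≢y = R-sym (All.lookup r x∈)
AllPairs-lookup R-sym (_ ∷ rs) (there x∈)   (there y∈)   x≢y = AllPairs-lookup R-sym rs x∈ y∈ x≢y

-- Positions and the three forms of the invariant.

Row : Set
Row = Fin 4

-- The choices (row , value) made so far, so A r = { z | (r , z) ∈ H }.
Position : Set
Position = List (Row × ℕ)

open DecMembership (≡-dec (Fin._≟_ {4}) ℕ._≟_) using (_∈?_)

private variable
  H : Position
  i j r s : Row
  x y z : ℕ

Guarded : Position → Set
Guarded H = Σ[ f ∈ (Row → ℕ) ] (∀ r → (r , f r) ∉ H) ×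
                                 (∀ r s → r ≢ s → (s , f r) ∈ H ⊎ (r , f s) ∈ H)

record IsMatching (m : Row → Row) : Set where
  field
    involutive : ∀ r → m (m r) ≡ r
    fixfree    : ∀ r → m r ≢ r

  ≢-partner : j ≢ m i → m j ≢ i
  ≢-partner {j} j≢mi mj≡i = j≢mi (trans (sym (involutive j)) (cong m mj≡i))

  partner-injective : m i ≡ m j → i ≡ j
  partner-injective {i} {j} eq = trans (sym (involutive i)) (trans (cong m eq) (involutive j))

  partner-rows : j ≢ i → j ≢ m i → Unique (i ∷ m i ∷ j ∷ m j ∷ [])
  partner-rows {j} {i} j≢i j≢mi =
    (≢-sym (fixfree i) ∷ ≢-sym j≢i ∷ ≢-sym (≢-partner j≢mi) ∷ []) ∷
    (≢-sym j≢mi ∷ (λ eq → j≢i (sym (partner-injective eq))) ∷ []) ∷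
    (≢-sym (fixfree j) ∷ []) ∷ [] ∷ []

-- Incomparability is witnessed by `f`: the partner of r has the value `f r`, which r lacks. The
-- `shared` value becomes a guard for a row of the other pair once a value crosses.
record Matched (H : Position) : Set where
  field
    m          : Row → Row
    isMatching : IsMatching m
    f          : Row → ℕ
    f-here     : ∀ r → (m r , f r) ∈ H
    f-fresh    : ∀ r → (r , f r) ∉ H
    separate   : ∀ {r s z} → s ≢ r → s ≢ m r → (r , z) ∈ H → (s , z) ∉ H
    shared     : ∃₂ λ r y → (r , y) ∈ H × (m r , y) ∈ H
  open IsMatching isMatching public

  f-back : ∀ r → (r , f (m r)) ∈ H
  f-back r = subst (λ t → (t , f (m r)) ∈ H) (involutive r) (f-here (m r))

-- Two values per row ensure that, whatever x is added, each row has a value other than x to witness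
-- incomparability.
record Disjoint (H : Position) : Set where
  field
    g h      : Row → ℕ
    g≢h      : ∀ r → g r ≢ h r
    g-here   : ∀ r → (r , g r) ∈ H
    h-here   : ∀ r → (r , h r) ∈ H
    separate : ∀ {r s z} → s ≢ r → (r , z) ∈ H → (s , z) ∉ H

data Safe (H : Position) : Set where
  guarded  : Guarded H → Safe H
  matched  : Matched H → Safe H
  disjoint : Disjoint H → Safe H

-- The separating value is a guard of one row lying in the other, or a value one partner has and the
-- other lacks, or, for rows without common values, any value of r.
Safe⇒separated : Safe H → r ≢ s →
  ∃[ z ] ((r , z) ∈ H × (s , z) ∉ H ⊎ (s , z) ∈ H × (r , z) ∉ H)
Safe⇒separated {r = r} {s} (guarded (f , f∉ , cover)) r≢s with cover r s r≢s
... | inj₁ fr∈s = f r , inj₂ (fr∈s , f∉ r)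
... | inj₂ fs∈r = f s , inj₁ (fs∈r , f∉ s)
Safe⇒separated {H} {r} {s} (matched M) r≢s with s Fin.≟ Matched.m M r
... | yes refl = f r , inj₂ (f-here r , f-fresh r)
  where open Matched M
... | no s≢mr = f (m r) , inj₁ (f-back r , separate (≢-sym r≢s) s≢mr (f-back r))
  where open Matched M
Safe⇒separated {r = r} (disjoint D) r≢s = g r , inj₁ (g-here r , separate (≢-sym r≢s) (g-here r))
  where open Disjoint D

-- Extending a position by one value.

∉-cons : (r ≡ i → z ≢ x) → (r , z) ∉ H → (r , z) ∉ (i , x) ∷ H
∉-cons ne z∉H (here refl)  = ne refl refl
∉-cons ne z∉H (there z∈H) = z∉H z∈H

∈-tail : r ≢ i → (r , z) ∈ (i , x) ∷ H → (r , z) ∈ H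
∈-tail r≢i (here refl)  = contradiction refl r≢i
∈-tail r≢i (there z∈H) = z∈H

Guards : Position → Row × ℕ → Row × ℕ → Set
Guards H (r , y) (s , z) = (s , y) ∈ H ⊎ (r , z) ∈ H

-- Allows guards to be given as a table of four rows; by symmetry of `Guards` only six pairs need
-- checking.
guards⇒Guarded : (gs : List (Row × ℕ)) → Unique (map proj₁ gs) → length (map proj₁ gs) ≡ 4 →
  All (_∉ H) gs → AllPairs (Guards H) gs → Guarded H
guards⇒Guarded {H} gs rows! ∣rows∣≡4 fresh guards =
  f , (λ r → All.lookup fresh (f-guard r)) ,
  (λ r s r≢s → AllPairs-lookup swap guards (f-guard r) (f-guard s) (r≢s ∘ cong proj₁))
  where
  guardOf : ∀ r → ∃[ p ] p ∈ gs × r ≡ proj₁ p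
  guardOf r = ∈-map⁻ proj₁ (Unique⇒∈ rows! ∣rows∣≡4 r)
  f : Row → ℕ
  f r = proj₂ (proj₁ (guardOf r))
  f-guard : ∀ r → (r , f r) ∈ gs
  f-guard r with guardOf r
  ... | _ , p∈gs , refl = p∈gs

-- Covering survives any addition; only the freshness of `f i` in row i is at risk.
guarded-step : Guarded H → ∀ i → ∃[ w ] ∀ x → x ≢ w → Guarded ((i , x) ∷ H)
guarded-step (f , f∉ , cover) i = f i , λ x x≢fi →
  f , (λ r → ∉-cons (λ { refl → ≢-sym x≢fi }) (f∉ r)) ,
  λ r s r≢s → [ inj₁ ∘ there , inj₂ ∘ there ]′ (cover r s r≢s)

module _ (M : Matched H) where
  open Matched M

  ∉-partner : s ≢ r → s ≢ m r → (s , z) ∈ H → (m r , z) ∉ H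
  ∉-partner {s} {r} s≢r s≢mr =
    separate (≢-sym s≢mr) λ eq → s≢r (sym (partner-injective eq))

  -- With b and d the partners of a and c, the value x is now in a and c but not in b. It guards b
  -- if d has it, and d otherwise; incomparability and the shared value provide the other guards.
  crossing-step : ∀ {a c x} → x ≢ f a → c ≢ a → c ≢ m a → (c , x) ∈ H →
                  Guarded ((a , x) ∷ H)
  crossing-step {a} {c} {x} x≢fa c≢a c≢b x∈c = result
    where
    b = m a
    d = m c
    b≢a = fixfree a
    d≢c = fixfree c
    d≢a : d ≢ a
    d≢a = ≢-partner c≢b
    d≢b : d ≢ b
    d≢b = c≢a ∘ partner-injective
    rows! : Unique (a ∷ b ∷ c ∷ d ∷ [])
    rows! = partner-rows c≢a c≢b
    x∉b : (b , x) ∉ H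
    x∉b = ∉-partner c≢a c≢b x∈c
    new : (a , x) ∈ (a , x) ∷ H
    new = here refl
    other : r ≢ a → (r , z) ∉ H → (r , z) ∉ (a , x) ∷ H
    other r≢a = ∉-cons (λ r≡a → contradiction r≡a r≢a)
    fa∉a : (a , f a) ∉ (a , x) ∷ H
    fa∉a = ∉-cons {H = H} (λ _ → ≢-sym x≢fa) (f-fresh a)
    fb∈a = f-back a
    fd∈c = f-back c
    fb∉c : (c , f b) ∉ H
    fb∉c = separate c≢a c≢b fb∈a
    fb∉d : (d , f b) ∉ H
    fb∉d = separate d≢a d≢b fb∈a
    fc∉b : (b , f c) ∉ H
    fc∉b = separate (≢-sym d≢b) (λ eq → b≢c (trans eq (involutive c))) (f-here c)
      where b≢c = ≢-sym c≢b
    shared-ab-or-cd : (∃[ y ] (a , y) ∈ H × (b , y) ∈ H) ⊎ (∃[ y ] (c , y) ∈ H × (d , y) ∈ H)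
    shared-ab-or-cd with shared
    ... | q , y , y∈q , y∈mq with Unique⇒∈ {4} rows! refl q
    ... | here refl                         = inj₁ (y , y∈q , y∈mq)
    ... | there (here refl)                 = inj₁ (y , subst (λ t → (t , y) ∈ H) (involutive a) y∈mq , y∈q)
    ... | there (there (here refl))         = inj₂ (y , y∈q , y∈mq)
    ... | there (there (there (here refl))) = inj₂ (y , subst (λ t → (t , y) ∈ H) (involutive c) y∈mq , y∈q)
    result : Guarded ((a , x) ∷ H)
    result with (d , x) ∈? H
    ... | yes x∈d = guards⇒Guarded
      ((a , f d) ∷ (b , x) ∷ (c , f c) ∷ (d , f b) ∷ []) rows! refl
      -- The added x is not `f d`, since d has x and lacks `f d`.
      (∉-cons (λ _ fd≡x → f-fresh d (subst (λ t → (d , t) ∈ H) (sym fd≡x) x∈d))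
              (separate (≢-sym c≢a) (λ eq → d≢a (sym eq)) fd∈c)
       ∷ other b≢a x∉b ∷ other c≢a (f-fresh c) ∷ other d≢a fb∉d ∷ [])
      ((inj₂ new ∷ inj₁ (there fd∈c) ∷ inj₂ (there fb∈a) ∷ []) ∷
       (inj₁ (there x∈c) ∷ inj₁ (there x∈d) ∷ []) ∷
       (inj₁ (there (f-here c)) ∷ []) ∷ [] ∷ [])
    ... | no x∉d with shared-ab-or-cd
    -- Rows a and b have y, which guards c; a and c have x, which guards d. The pairs a, b and b, d
    -- are left to `f a` in b and `f c` in d.
    ... | inj₁ (y , y∈a , y∈b) = guards⇒Guarded
      ((a , f a) ∷ (b , f c) ∷ (c , y) ∷ (d , x) ∷ []) rows! refl
      (fa∉a ∷ other b≢a fc∉b ∷ other c≢a (separate c≢a c≢b y∈a) ∷ other d≢a x∉d ∷ [])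
      ((inj₁ (there (f-here a)) ∷ inj₂ (there y∈a) ∷ inj₂ new ∷ []) ∷
       (inj₂ (there y∈b) ∷ inj₁ (there (f-here c)) ∷ []) ∷
       (inj₂ (there x∈c) ∷ []) ∷ [] ∷ [])
    -- Rows c and d have y, which guards b; x guards d as before. The pairs a, b and a, c are left
    -- to `f a` in b and `f b` in a.
    ... | inj₂ (y , y∈c , y∈d) = guards⇒Guarded
      ((a , f a) ∷ (b , y) ∷ (c , f b) ∷ (d , x) ∷ []) rows! refl
      (fa∉a ∷ other b≢a (∉-partner c≢a c≢b y∈c) ∷ other c≢a fb∉c ∷ other d≢a x∉d ∷ [])
      ((inj₁ (there (f-here a)) ∷ inj₂ (there fb∈a) ∷ inj₂ new ∷ []) ∷
       (inj₁ (there y∈c) ∷ inj₁ (there y∈d) ∷ []) ∷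
       (inj₂ (there x∈c) ∷ []) ∷ [] ∷ [])

-- Avoiding `f i` keeps the partners incomparable, so the form persists unless x already occurs in
-- the other pair, which is the crossing case.
matched-step : Matched H → ∀ i → ∃[ w ] ∀ x → x ≢ w → Safe ((i , x) ∷ H)
matched-step {H} M i = f i , step
  where
  open Matched M
  step : ∀ x → x ≢ f i → Safe ((i , x) ∷ H)
  step x x≢fi with any? (λ c → ¬? (c Fin.≟ i) ×-dec ¬? (c Fin.≟ m i) ×-dec (c , x) ∈? H)
  ... | yes (c , c≢i , c≢mi , x∈c) = guarded (crossing-step M x≢fi c≢i c≢mi x∈c)
  ... | no ¬crossing = matched record
    { isMatching = isMatching
    ; f          = f
    ; f-here     = there ∘ f-here
    ; f-fresh    = λ r → ∉-cons (λ { refl → ≢-sym x≢fi }) (f-fresh r)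
    ; separate   = separate′
    ; shared     = let r , y , y∈r , y∈mr = shared in r , y , there y∈r , there y∈mr
    }
    where
    separate′ : ∀ {r s z} → s ≢ r → s ≢ m r → (r , z) ∈ (i , x) ∷ H → (s , z) ∉ (i , x) ∷ H
    separate′ s≢r s≢mr (here refl) s∋ = ¬crossing (_ , s≢r , s≢mr , ∈-tail s≢r s∋)
    separate′ s≢r s≢mr (there r∋)  (here refl) =
      ¬crossing (_ , ≢-sym s≢r , ≢-sym (≢-partner s≢mr) , r∋)
    separate′ s≢r s≢mr (there r∋)  (there s∋) = separate s≢r s≢mr r∋ s∋

-- The three perfect matchings of four rows; any two distinct rows are partners in exactly one of
-- them.
matching : Fin 3 → Row → Row
matching k = lookup (lookup ((1F ∷ 0F ∷ 3F ∷ 2F ∷ []) ∷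
                             (2F ∷ 3F ∷ 0F ∷ 1F ∷ []) ∷
                             (3F ∷ 2F ∷ 1F ∷ 0F ∷ []) ∷ []) k)

matching-isMatching : ∀ k → IsMatching (matching k)
matching-isMatching k = record
  { involutive = from-yes (all? λ k → all? λ r → matching k (matching k r) Fin.≟ r) k
  ; fixfree    = from-yes (all? λ k → all? λ r → ¬? (matching k r Fin.≟ r)) k
  }

rows-ending : ∀ d → Unique (matching 0F d ∷ matching 1F d ∷ matching 2F d ∷ d ∷ [])
rows-ending = from-yes (all? λ d → unique? (matching 0F d ∷ matching 1F d ∷ matching 2F d ∷ d ∷ []))

matchingWith : i ≢ j → Σ[ m ∈ (Row → Row) ] IsMatching m × m i ≡ j
matchingWith {i} {j} i≢j with from-yes (all? λ i → all? λ j →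
  i Fin.≟ j ⊎-dec any? λ k → matching k i Fin.≟ j) i j
... | inj₁ i≡j       = contradiction i≡j i≢j
... | inj₂ (k , eq) = matching k , matching-isMatching k , eq

-- If x already lies in another row c, then c is made the partner of i and x is the shared value;
-- all other common values are excluded by the old disjointness.
disjoint-step : Disjoint H → ∀ i x → Safe ((i , x) ∷ H)
disjoint-step {H} D i x with any? (λ c → ¬? (c Fin.≟ i) ×-dec (c , x) ∈? H)
... | no ¬crossing = disjoint record
  { g≢h = g≢h ; g-here = there ∘ g-here ; h-here = there ∘ h-here ; separate = separate′ }
  where
  open Disjoint D
  separate′ : ∀ {r s z} → s ≢ r → (r , z) ∈ (i , x) ∷ H → (s , z) ∉ (i , x) ∷ H
  separate′ s≢r (here refl) s∋          = ¬crossing (_ , s≢r , ∈-tail s≢r s∋)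
  separate′ s≢r (there r∋)  (here refl) = ¬crossing (_ , ≢-sym s≢r , r∋)
  separate′ s≢r (there r∋)  (there s∋)  = separate s≢r r∋ s∋
... | yes (c , c≢i , x∈c) with matchingWith (≢-sym c≢i)
... | m , isMatching , refl = matched record
  { isMatching = isMatching
  -- A value of the partner other than x: disjointness kept it out of r, and adding x does not bring
  -- it in.
  ; f          = e ∘ m
  ; f-here     = λ r → there (proj₁ (proj₂ (surviving (m r))))
  ; f-fresh    = λ r → ∉-cons (λ _ → proj₂ (proj₂ (surviving (m r))))
                              (separate (≢-sym (fixfree r)) (proj₁ (proj₂ (surviving (m r)))))
  ; separate   = separate′
  ; shared     = i , x , here refl , there x∈c
  }
  where
  open Disjoint D
  open IsMatching isMatching
  surviving : ∀ r → ∃[ y ] (r , y) ∈ H × y ≢ x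
  surviving r with g r ℕ.≟ x
  ... | yes g≡x = h r , h-here r , λ h≡x → g≢h r (trans g≡x (sym h≡x))
  ... | no  g≢x = g r , g-here r , g≢x
  e : Row → ℕ
  e r = proj₁ (surviving r)
  separate′ : ∀ {r s z} → s ≢ r → s ≢ m r → (r , z) ∈ (i , x) ∷ H → (s , z) ∉ (i , x) ∷ H
  separate′ s≢r s≢mr (here refl) s∋ = separate (≢-sym s≢mr) (∈-tail s≢r s∋) x∈c
  separate′ s≢r s≢mr (there r∋)  (here refl) = separate (≢-partner s≢mr) r∋ x∈c
  separate′ s≢r s≢mr (there r∋)  (there s∋) = separate s≢r r∋ s∋

safe-step : Safe H → ∀ i → ∃[ w ] ∀ x → x ≢ w → Safe ((i , x) ∷ H)
safe-step (guarded G)  i = let w , step = guarded-step G i in w , λ x → guarded ∘ step x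
safe-step (matched M)  i = matched-step M i
-- Every x is admissible here, so 0 is an arbitrary default.
safe-step (disjoint D) i = 0 , λ x _ → disjoint-step D i x

-- Whole columns, and reorderings of four rows.

column : (Row → ℕ) → Position
column f = tabulate λ r → r , f r

∈-column⁺ : ∀ f H r → (r , f r) ∈ column f ++ H
∈-column⁺ f H r = ∈-++⁺ˡ (∈-tabulate⁺ {f = λ r → r , f r} r)

∈-column⁻ : ∀ f → (r , z) ∈ column f ++ H → z ≡ f r ⊎ (r , z) ∈ H
∈-column⁻ f rz∈ with ∈-++⁻ (column f) rz∈
... | inj₂ rz∈H = inj₂ rz∈H
... | inj₁ rz∈f with ∈-tabulate⁻ {f = λ r → r , f r} rz∈f
... | _ , refl = inj₁ refl

rotate : ∀ {a b c d : Row} → Unique (a ∷ b ∷ c ∷ d ∷ []) → Unique (b ∷ c ∷ d ∷ a ∷ [])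
rotate ((a≢b ∷ a≢c ∷ a≢d ∷ []) ∷ (b≢c ∷ b≢d ∷ []) ∷ (c≢d ∷ []) ∷ [] ∷ []) =
  (b≢c ∷ b≢d ∷ ≢-sym a≢b ∷ []) ∷ (c≢d ∷ ≢-sym a≢c ∷ []) ∷ (≢-sym a≢d ∷ []) ∷ [] ∷ []

transpose₁₂ : ∀ {a b c d : Row} → Unique (a ∷ b ∷ c ∷ d ∷ []) → Unique (b ∷ a ∷ c ∷ d ∷ [])
transpose₁₂ ((a≢b ∷ a∉) ∷ b∉ ∷ cd!) = (≢-sym a≢b ∷ b∉) ∷ a∉ ∷ cd!

transpose₂₃ : ∀ {a b c d : Row} → Unique (a ∷ b ∷ c ∷ d ∷ []) → Unique (a ∷ c ∷ b ∷ d ∷ [])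
transpose₂₃ = rotate ∘ rotate ∘ rotate ∘ transpose₁₂ ∘ rotate

transpose₃₄ : ∀ {a b c d : Row} → Unique (a ∷ b ∷ c ∷ d ∷ []) → Unique (a ∷ b ∷ d ∷ c ∷ [])
transpose₃₄ = rotate ∘ rotate ∘ transpose₁₂ ∘ rotate ∘ rotate

-- The first two columns

module Opening (e : Row → ℕ) (e-injective : ∀ {r s} → e r ≡ e s → r ≡ s) where

  opening : (Row → ℕ) → Position
  opening x = column x ++ column e ++ []

  e-distinct : r ≢ s → e r ≢ e s
  e-distinct r≢s = r≢s ∘ e-injective

  module _ (x : Row → ℕ) where

    e∈ : ∀ r → (r , e r) ∈ opening x
    e∈ r = ∈-++⁺ʳ (column x) (∈-column⁺ e [] r)

    x∈ : ∀ r → (r , x r) ∈ opening x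
    x∈ r = ∈-column⁺ x (column e ++ []) r

    ∈-opening⁻ : (r , z) ∈ opening x → z ≡ e r ⊎ z ≡ x r
    ∈-opening⁻ rz∈ with ∈-column⁻ x rz∈
    ... | inj₁ z≡x = inj₂ z≡x
    ... | inj₂ rz∈e with ∈-column⁻ e rz∈e
    ... | inj₁ z≡e = inj₁ z≡e

    ∉-opening : z ≢ e r → z ≢ x r → (r , z) ∉ opening x
    ∉-opening z≢e z≢x rz∈ = [ z≢e , z≢x ]′ (∈-opening⁻ rz∈)

    -- Values are shared along the path c, d, a: `e d` lies in c and d and guards b, `e a` lies in d
    -- and a and guards c. Rows a and d are guarded by `e b` and `x a`.
    path-opening : ∀ {a b c d} → Unique (a ∷ b ∷ c ∷ d ∷ []) →
      x c ≡ e d → x d ≡ e a → x a ≢ e a → x a ≢ e b → x a ≢ e d → x b ≢ e d →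
      Guarded (opening x)
    path-opening {a} {b} {c} {d}
      rows!@((a≢b ∷ a≢c ∷ a≢d ∷ []) ∷ (b≢c ∷ b≢d ∷ []) ∷ (c≢d ∷ []) ∷ [] ∷ [])
      xc≡ed xd≡ea xa≢ea xa≢eb xa≢ed xb≢ed =
      guards⇒Guarded ((a , e b) ∷ (b , e d) ∷ (c , e a) ∷ (d , x a) ∷ []) rows! refl
        (∉-opening (e-distinct (≢-sym a≢b)) (≢-sym xa≢eb) ∷
         ∉-opening (e-distinct (≢-sym b≢d)) (≢-sym xb≢ed) ∷
         ∉-opening (e-distinct a≢c) (λ eq → e-distinct a≢d (trans eq xc≡ed)) ∷
         ∉-opening xa≢ed (λ eq → xa≢ea (trans eq xd≡ea)) ∷ [])
        ((inj₁ (e∈ b) ∷ inj₂ (e∈ a) ∷ inj₂ (x∈ a) ∷ []) ∷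
         (inj₁ (subst (λ z → (c , z) ∈ opening x) xc≡ed (x∈ c)) ∷ inj₁ (e∈ d) ∷ []) ∷
         (inj₁ (subst (λ z → (d , z) ∈ opening x) xd≡ea (x∈ d)) ∷ []) ∷ [] ∷ [])

    -- The common value guards d, while a, b, c are guarded cyclically by each other's first values.
    triple-opening : ∀ {a b c d} → Unique (a ∷ b ∷ c ∷ d ∷ []) →
      x b ≡ x a → x c ≡ x a → (∀ r → x a ≢ e r) → x d ≢ x a → Guarded (opening x)
    triple-opening {a} {b} {c} {d}
      rows!@((a≢b ∷ a≢c ∷ a≢d ∷ []) ∷ (b≢c ∷ b≢d ∷ []) ∷ (c≢d ∷ []) ∷ [] ∷ [])
      xb≡xa xc≡xa xa≢e xd≢xa =
      guards⇒Guarded ((a , e b) ∷ (b , e c) ∷ (c , e a) ∷ (d , x a) ∷ []) rows! refl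
        (∉-opening (e-distinct (≢-sym a≢b)) (≢-sym (xa≢e b)) ∷
         ∉-opening (e-distinct (≢-sym b≢c)) (λ eq → xa≢e c (sym (trans eq xb≡xa))) ∷
         ∉-opening (e-distinct a≢c) (λ eq → xa≢e a (sym (trans eq xc≡xa))) ∷
         ∉-opening (xa≢e d) (≢-sym xd≢xa) ∷ [])
        ((inj₁ (e∈ b) ∷ inj₂ (e∈ a) ∷ inj₂ (x∈ a) ∷ []) ∷
         (inj₁ (e∈ c) ∷ inj₂ (subst (λ z → (b , z) ∈ opening x) xb≡xa (x∈ b)) ∷ []) ∷
         (inj₂ (subst (λ z → (c , z) ∈ opening x) xc≡xa (x∈ c)) ∷ []) ∷ [] ∷ [])

    -- For r ≠ s this is disjointness of their two-column value sets, since the first values differ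
    -- anyway.
    Apart : Row → Row → Set
    Apart r s = x r ≢ x s × x r ≢ e s × x s ≢ e r

    apart-separates : r ≢ s → Apart r s → (r , z) ∈ opening x → (s , z) ∉ opening x
    apart-separates r≢s (xr≢xs , xr≢es , xs≢er) rz∈ sz∈ with ∈-opening⁻ rz∈ | ∈-opening⁻ sz∈
    ... | inj₁ refl | inj₁ eq = e-distinct r≢s eq
    ... | inj₁ refl | inj₂ eq = xs≢er (sym eq)
    ... | inj₂ refl | inj₁ eq = xr≢es eq
    ... | inj₂ refl | inj₂ eq = xr≢xs eq

    -- Any coincidence between rows lies within a pair and gives the shared value; without one the
    -- position is Disjoint. Two-element sets are incomparable unless equal, and partners with equal
    -- sets would have exchanged their first values.
    matched-opening : ∀ {m} → IsMatching m → (∀ r → x r ≢ e r) →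
      (∀ {r s} → s ≢ r → s ≢ m r → Apart r s) →
      (∀ r → ¬ (x r ≡ e (m r) × x (m r) ≡ e r)) → Safe (opening x)
    matched-opening {m} isMatching x≢e apart ¬exchange
      with any? (λ r → any? λ s → ¬? (s Fin.≟ r) ×-dec
                 (x r ℕ.≟ x s ⊎-dec x r ℕ.≟ e s))
    ... | no ¬touching = disjoint record
      { g≢h = λ r → ≢-sym (x≢e r) ; g-here = e∈ ; h-here = x∈
      ; separate = λ {r} {s} s≢r → apart-separates (≢-sym s≢r)
          ( (λ eq → ¬touching (r , s , s≢r , inj₁ eq))
          , (λ eq → ¬touching (r , s , s≢r , inj₂ eq))
          , (λ eq → ¬touching (s , r , ≢-sym s≢r , inj₂ eq)))
      }
    ... | yes (r , s , s≢r , touch) = matched record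
      { isMatching = isMatching
      ; f          = λ r → proj₁ (guard r)
      ; f-here     = λ r → proj₁ (proj₂ (guard r))
      ; f-fresh    = λ r → proj₂ (proj₂ (guard r))
      ; separate   = λ s≢r s≢mr → apart-separates (≢-sym s≢r) (apart s≢r s≢mr)
      ; shared     = r , x r , x∈ r , shared-at-partner touch
      }
      where
      open IsMatching isMatching
      guard : ∀ r → ∃[ z ] (m r , z) ∈ opening x × (r , z) ∉ opening x
      guard r with x r ℕ.≟ e (m r)
      ... | no xr≢e = e (m r) , e∈ (m r) , ∉-opening (e-distinct (fixfree r)) (≢-sym xr≢e)
      ... | yes xr≡e = x (m r) , x∈ (m r) ,
        ∉-opening (λ eq → ¬exchange r (xr≡e , eq)) (λ eq → x≢e (m r) (trans eq xr≡e))
      shared-at-partner : x r ≡ x s ⊎ x r ≡ e s → (m r , x r) ∈ opening x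
      shared-at-partner touch with s Fin.≟ m r | touch
      ... | yes refl | inj₁ xr≡xs = subst (λ z → (m r , z) ∈ opening x) (sym xr≡xs) (x∈ (m r))
      ... | yes refl | inj₂ xr≡es = subst (λ z → (m r , z) ∈ opening x) (sym xr≡es) (e∈ (m r))
      ... | no s≢mr  | inj₁ xr≡xs = contradiction xr≡xs (proj₁ (apart s≢r s≢mr))
      ... | no s≢mr  | inj₂ xr≡es = contradiction xr≡es (proj₁ (proj₂ (apart s≢r s≢mr)))

    -- The pairs are a, b and c, d. An exchange needs two rows taking first-column values, and only
    -- d may do so.
    pairs-opening : ∀ {a b c d} → Unique (a ∷ b ∷ c ∷ d ∷ []) →
      (∀ r → x r ≢ e r) → (∀ r → r ≢ d → ∀ s → x r ≢ e s) →
      Apart a c → Apart a d → Apart b c → Apart b d → Safe (opening x)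
    pairs-opening {a} {b} {c} {d} rows!@((a≢b ∷ a≢c ∷ a≢d ∷ []) ∷ (b≢c ∷ b≢d ∷ []) ∷ _)
      x≢e x∉e ac ad bc bd with matchingWith a≢b
    ... | m , isMatching , refl = matched-opening isMatching x≢e
      (λ {r} {s} s≢r s≢mr → AllPairs-lookup Across-sym
        ((b-impossible ∷ (λ _ _ → ac) ∷ (λ _ _ → ad) ∷ []) ∷
         ((λ _ _ → bc) ∷ (λ _ _ → bd) ∷ []) ∷
         ((λ _ d≢mc → contradiction mc≡d (≢-sym d≢mc)) ∷ []) ∷ [] ∷ [])
        (Unique⇒∈ rows! refl r) (Unique⇒∈ rows! refl s) (≢-sym s≢r) s≢r s≢mr)
      ¬exchange
      where
      open IsMatching isMatching
      Across : Row → Row → Set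
      Across r s = s ≢ r → s ≢ m r → Apart r s
      Across-sym : Symmetric Across
      Across-sym across r≢s r≢ms =
        let xr≢xs , xr≢es , xs≢er = across (≢-sym r≢s) (≢-sym (≢-partner r≢ms))
        in ≢-sym xr≢xs , xs≢er , xr≢es
      b-impossible : Across a (m a)
      b-impossible _ ma≢ma = contradiction refl ma≢ma
      mc≡d : m c ≡ d
      mc≡d with Unique⇒∈ {4} rows! refl (m c)
      ... | here mc≡a                          = contradiction mc≡a (≢-partner (≢-sym b≢c))
      ... | there (here mc≡ma)                 = contradiction (sym (partner-injective mc≡ma)) a≢c
      ... | there (there (here mc≡c))          = contradiction mc≡c (fixfree c)
      ... | there (there (there (here mc≡d))) = mc≡d
      ¬exchange : ∀ r → ¬ (x r ≡ e (m r) × x (m r) ≡ e r)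
      ¬exchange r (xr≡e , xmr≡e) with r Fin.≟ d
      ... | no r≢d   = x∉e r r≢d (m r) xr≡e
      ... | yes refl = x∉e (m r) (fixfree r) r xmr≡e

    -- Row d is paired with a, whose value it repeats, unless b has that value too; then c alone
    -- lacks it.
    doubled-opening : ∀ {a b c d} → Unique (a ∷ b ∷ c ∷ d ∷ []) →
      (∀ r → x r ≢ e r) → (∀ r → r ≢ d → ∀ s → x r ≢ e s) →
      x d ≡ x a → x c ≢ x a → x c ≢ x b → Safe (opening x)
    doubled-opening {a} {b} {c} {d}
      rows!@((a≢b ∷ a≢c ∷ a≢d ∷ []) ∷ (b≢c ∷ b≢d ∷ []) ∷ (c≢d ∷ []) ∷ [] ∷ [])
      x≢e x∉e xd≡xa xc≢xa xc≢xb with x b ℕ.≟ x a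
    ... | yes xb≡xa =
      guarded (triple-opening (transpose₃₄ rows!) xb≡xa xd≡xa (x∉e a a≢d) xc≢xa)
    ... | no xb≢xa = pairs-opening (transpose₂₃ (transpose₁₂ rows!)) x≢e x∉e
      (xb≢xa , x∉e b b≢d a , x∉e a a≢d b)
      ((λ eq → xb≢xa (trans eq xd≡xa)) , x∉e b b≢d d , xd∉e b)
      (xc≢xa , x∉e c c≢d a , x∉e a a≢d c)
      ((λ eq → xc≢xa (trans eq xd≡xa)) , x∉e c c≢d d , xd∉e c)
      where
      xd∉e : ∀ s → x d ≢ e s
      xd∉e s eq = x∉e a a≢d s (trans (sym xd≡xa) eq)

    -- Pairing a with b and c with d works unless `x d` repeats the value of a or b. It may equal
    -- `e c`, as that stays within a pair.
    oddOneOut-opening : ∀ {a b c d} → Unique (a ∷ b ∷ c ∷ d ∷ []) →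
      (∀ r → x r ≢ e r) → (∀ r → r ≢ d → ∀ s → x r ≢ e s) →
      x d ≢ e a → x d ≢ e b → x c ≢ x a → x c ≢ x b → Safe (opening x)
    oddOneOut-opening {a} {b} {c} {d}
      rows!@((a≢b ∷ a≢c ∷ a≢d ∷ []) ∷ (b≢c ∷ b≢d ∷ []) ∷ (c≢d ∷ []) ∷ [] ∷ [])
      x≢e x∉e xd≢ea xd≢eb xc≢xa xc≢xb with x d ℕ.≟ x a | x d ℕ.≟ x b
    ... | yes xd≡xa | _         = doubled-opening rows! x≢e x∉e xd≡xa xc≢xa xc≢xb
    ... | no _      | yes xd≡xb =
      doubled-opening (transpose₁₂ rows!) x≢e x∉e xd≡xb xc≢xb xc≢xa
    ... | no xd≢xa  | no xd≢xb  = pairs-opening rows! x≢e x∉e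
      (≢-sym xc≢xa , x∉e a a≢d c , x∉e c c≢d a)
      (≢-sym xd≢xa , x∉e a a≢d d , xd≢ea)
      (≢-sym xc≢xb , x∉e b b≢d c , x∉e c c≢d b)
      (≢-sym xd≢xb , x∉e b b≢d d , xd≢eb)

  -- Choosing the second column from lists of four values.

  module _ (T : Row → List ℕ) (T! : ∀ r → Unique (T r)) (∣T∣≡4 : ∀ r → length (T r) ≡ 4) where

    pick-avoiding : ∀ r ys → length ys ≤ 3 → ∃[ v ] v ∈ T r × v ∉ ys
    pick-avoiding r ys ∣ys∣≤3 =
      pick ℕ._≟_ ys (T! r) (ℕ.≤-trans (s≤s ∣ys∣≤3) (ℕ.≤-reflexive (sym (∣T∣≡4 r))))

    SafeOpening : Set
    SafeOpening = Σ[ x ∈ (Row → ℕ) ] (∀ r → x r ∈ T r × x r ≢ e r) × Safe (opening x)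

    -- With two stuck rows c and d, let c take e d and d take e a. Otherwise at most one row d is not free, and
    -- either the free values of the other three rows all agree or one of them differs from both others.
    Free Stuck : Row → Set
    Free  r = ∃[ v ] v ∈ T r × (∀ s → v ≢ e s)
    Stuck r = ∀ s → e s ∈ T r

    stuck? : ∀ r → Dec (Stuck r)
    stuck? r = all? λ s → DecMembership._∈?_ ℕ._≟_ (e s) (T r)

    -- Some `e s` is missing from the list, and the three other first values cannot exhaust its four
    -- elements.
    ¬stuck⇒free : ∀ r → ¬ Stuck r → Free r
    ¬stuck⇒free r ¬stuck
      with s , es∉T ← Fin.¬∀⟶∃¬ 4 _ (λ s → DecMembership._∈?_ ℕ._≟_ (e s) (T r)) ¬stuck
      with v , v∈T , v∉ ← pick-avoiding r (map (e ∘ punchIn s) (allFin 3)) ℕ.≤-refl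
      = v , v∈T , v≢e
      where
      v≢e : ∀ t → v ≢ e t
      v≢e t refl with s Fin.≟ t
      ... | yes refl = es∉T v∈T
      ... | no s≢t = v∉ (subst (λ u → e u ∈ _) (Fin.punchIn-punchOut s≢t)
                          (∈-map⁺ (e ∘ punchIn s) (∈-allFin (punchOut s≢t))))

    twoStuck-opening : ∀ {a b c d} → Unique (a ∷ b ∷ c ∷ d ∷ []) →
                       Stuck c → Stuck d → SafeOpening
    twoStuck-opening {a} {b} {c} {d}
      rows!@((a≢b ∷ a≢c ∷ a≢d ∷ []) ∷ (b≢c ∷ b≢d ∷ []) ∷ (c≢d ∷ []) ∷ [] ∷ []) c-stuck d-stuck =
      x₁ , (λ r → proj₁ (proj₂ (choice r)) , proj₁ (proj₂ (proj₂ (choice r)))) ,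
      guarded (path-opening x₁ rows! (x-c refl) (x-d refl)
        (x≢e a) (proj₁ (x-ab a≢c a≢d)) (proj₂ (x-ab a≢c a≢d)) (proj₂ (x-ab b≢c b≢d)))
      where
      choice : ∀ r → ∃[ v ] v ∈ T r × v ≢ e r × (r ≡ c → v ≡ e d) × (r ≡ d → v ≡ e a) ×
                            (r ≢ c → r ≢ d → v ≢ e b × v ≢ e d)
      choice r with r Fin.≟ c | r Fin.≟ d
      ... | yes refl | _ =
        e d , c-stuck d , e-distinct (≢-sym c≢d) , (λ _ → refl) ,
        (λ eq → contradiction eq c≢d) , λ c≢c → contradiction refl c≢c
      ... | no _ | yes refl =
        e a , d-stuck a , e-distinct a≢d , (λ eq → contradiction eq (≢-sym c≢d)) ,
        (λ _ → refl) , λ _ d≢d → contradiction refl d≢d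
      ... | no r≢c | no r≢d
        -- Here r is a or b; the list contains all that `path-opening` forbids either of them.
        with v , v∈T , v∉ ← pick-avoiding r (e r ∷ e b ∷ e d ∷ []) ℕ.≤-refl =
        v , v∈T , v∉ ∘ here , (λ r≡c → contradiction r≡c r≢c) ,
        (λ r≡d → contradiction r≡d r≢d) ,
        λ _ _ → v∉ ∘ there ∘ here , v∉ ∘ there ∘ there ∘ here
      x₁ : Row → ℕ
      x₁ r = proj₁ (choice r)
      x≢e : ∀ r → x₁ r ≢ e r
      x≢e r = let _ , _ , x≢e , _ = choice r in x≢e
      x-c : ∀ {r} → r ≡ c → x₁ r ≡ e d
      x-c {r} = let _ , _ , _ , x-c , _ = choice r in x-c
      x-d : ∀ {r} → r ≡ d → x₁ r ≡ e a
      x-d {r} = let _ , _ , _ , _ , x-d , _ = choice r in x-d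
      x-ab : ∀ {r} → r ≢ c → r ≢ d → x₁ r ≢ e b × x₁ r ≢ e d
      x-ab {r} = let _ , _ , _ , _ , _ , x-ab = choice r in x-ab

    module _ {d} (free : ∀ r → r ≢ d → Free r) where

      -- The value u of row d stays a parameter because it is chosen in view of the free values of
      -- the other rows.
      place : ℕ → Row → ℕ
      place u r with r Fin.≟ d
      ... | yes _  = u
      ... | no r≢d = proj₁ (free r r≢d)

      place-there : ∀ u → place u d ≡ u
      place-there u with d Fin.≟ d
      ... | yes _  = refl
      ... | no d≢d = contradiction refl d≢d

      w : Row → ℕ
      -- The 0 is a placeholder: `w` is consulted only at rows other than d.
      w = place 0

      place-w : ∀ u → r ≢ d → place u r ≡ w r
      place-w {r} u r≢d with r Fin.≟ d
      ... | yes r≡d = contradiction r≡d r≢d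
      ... | no  _   = refl

      place-∉e : ∀ u r → r ≢ d → ∀ s → place u r ≢ e s
      place-∉e u r r≢d with r Fin.≟ d
      ... | yes r≡d  = contradiction r≡d r≢d
      ... | no  r≢d′ = proj₂ (proj₂ (free r r≢d′))

      place-legal : ∀ {u} → u ∈ T d → u ≢ e d → ∀ r → place u r ∈ T r × place u r ≢ e r
      place-legal u∈T u≢e r with r Fin.≟ d
      ... | yes refl = u∈T , u≢e
      ... | no r≢d   = let _ , v∈T , v≢e = free r r≢d in v∈T , v≢e r

      oddOneOut : ∀ {a b c} → Unique (a ∷ b ∷ c ∷ d ∷ []) → w c ≢ w a → w c ≢ w b → SafeOpening
      oddOneOut {a} {b} {c}
        rows!@((_ ∷ _ ∷ a≢d ∷ []) ∷ (_ ∷ b≢d ∷ []) ∷ (c≢d ∷ []) ∷ _) wc≢wa wc≢wb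
        with u , u∈T , u∉ ← pick-avoiding d (e d ∷ e a ∷ e b ∷ []) ℕ.≤-refl =
        place u , legal ,
        oddOneOut-opening (place u) rows! (proj₂ ∘ legal) (place-∉e u)
          (subst (_≢ e a) (sym (place-there u)) (u∉ ∘ there ∘ here))
          (subst (_≢ e b) (sym (place-there u)) (u∉ ∘ there ∘ there ∘ here))
          (λ eq → wc≢wa (trans (sym (place-w u c≢d)) (trans eq (place-w u a≢d))))
          (λ eq → wc≢wb (trans (sym (place-w u c≢d)) (trans eq (place-w u b≢d))))
        where
        legal = place-legal u∈T (u∉ ∘ here)

      allEqual : ∀ {a b c} → Unique (a ∷ b ∷ c ∷ d ∷ []) → w b ≡ w a → w c ≡ w a → SafeOpening
      allEqual {a} {b} {c}
        rows!@((_ ∷ _ ∷ a≢d ∷ []) ∷ (_ ∷ b≢d ∷ []) ∷ (c≢d ∷ []) ∷ _) wb≡wa wc≡wa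
        with u , u∈T , u∉ ← pick-avoiding d (e d ∷ w a ∷ []) (s≤s (s≤s z≤n)) =
        place u , place-legal u∈T (u∉ ∘ here) ,
        guarded (triple-opening (place u) rows!
          (trans (place-w u b≢d) (trans wb≡wa (sym (place-w u a≢d))))
          (trans (place-w u c≢d) (trans wc≡wa (sym (place-w u a≢d))))
          (place-∉e u a a≢d)
          (λ eq → u∉ (there (here (trans (sym (place-there u)) (trans eq (place-w u a≢d)))))))

      threeFree-opening : ∀ {a b c} → Unique (a ∷ b ∷ c ∷ d ∷ []) → SafeOpening
      threeFree-opening {a} {b} {c} rows! with w b ℕ.≟ w a | w c ℕ.≟ w a
      ... | yes wb≡wa | yes wc≡wa = allEqual rows! wb≡wa wc≡wa
      ... | yes wb≡wa | no wc≢wa  = oddOneOut rows! wc≢wa (λ eq → wc≢wa (trans eq wb≡wa))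
      ... | no wb≢wa  | yes wc≡wa =
        oddOneOut (transpose₂₃ rows!) wb≢wa (λ eq → wb≢wa (trans eq wc≡wa))
      ... | no wb≢wa  | no wc≢wa  =
        oddOneOut (transpose₂₃ (transpose₁₂ rows!)) (≢-sym wb≢wa) (≢-sym wc≢wa)

    safeOpening : SafeOpening
    safeOpening with any? stuck?
    ... | no ¬stuck =
      -- All rows are free, so the choice of the last row is arbitrary.
      threeFree-opening (λ r _ → ¬stuck⇒free r λ r-stuck → ¬stuck (r , r-stuck)) (rows-ending 0F)
    ... | yes (d , d-stuck) with any? (λ c → ¬? (c Fin.≟ d) ×-dec stuck? c)
    ... | no ¬another =
      threeFree-opening (λ r r≢d → ¬stuck⇒free r λ r-stuck → ¬another (r , r≢d , r-stuck))
                        (rows-ending d)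
    ... | yes (c , c≢d , c-stuck)
      -- Any third row will do; its partner in the matching of c with d is the fourth.
      with a , _ , a∉ ← pick Fin._≟_ (c ∷ d ∷ []) (allFin⁺ 4) (s≤s (s≤s (s≤s z≤n)))
         | m , isMatching , refl ← matchingWith c≢d =
      twoStuck-opening
        (rotate (rotate (IsMatching.partner-rows isMatching (a∉ ∘ here) (a∉ ∘ there ∘ here))))
        c-stuck d-stuck


-- Filling the remaining columns.

module Play (S : Row → ℕ → List ℕ) (S! : ∀ i j → Unique (S i j))
            (∣S∣≡4 : ∀ i j → length (S i j) ≡ 4)
            (e : Row → ℕ) (e-injective : ∀ {r s} → e r ≡ e s → r ≡ s) (x₁ : Row → ℕ)
            (safe-opening : Safe (Opening.opening e e-injective x₁)) where

  open Opening e e-injective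

  Legal : ℕ → Row → ℕ → Set
  Legal j i v = v ∈ S i j × v ≢ e i × v ≢ x₁ i

  row-step : ∀ j → Safe H → ∀ i → ∃[ v ] Legal j i v × Safe ((i , v) ∷ H)
  row-step j safe i
    with w , step ← safe-step safe i
    with v , v∈S , v∉ ← pick ℕ._≟_ (e i ∷ x₁ i ∷ w ∷ []) (S! i j)
                             (ℕ.≤-reflexive (sym (∣S∣≡4 i j)))
    = v , (v∈S , v∉ ∘ here , v∉ ∘ there ∘ here) , step v (v∉ ∘ there ∘ there ∘ here)

  -- Unfolding the strategy makes the checks below infeasible.
  abstract
    column-step : ∀ j → Safe H →
      Σ[ x ∈ (Row → ℕ) ] (∀ i → Legal j i (x i)) × Safe (column x ++ H)
    column-step j safe
      -- Going from the last row to the first makes the successive conses agree definitionally with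
      -- `column x ++ H`.
      with v₃ , legal₃ , safe₃ ← row-step j safe  3F
      with v₂ , legal₂ , safe₂ ← row-step j safe₃ 2F
      with v₁ , legal₁ , safe₁ ← row-step j safe₂ 1F
      with v₀ , legal₀ , safe₀ ← row-step j safe₁ 0F
      = lookup (v₀ ∷ v₁ ∷ v₂ ∷ v₃ ∷ []) ,
        (λ { 0F → legal₀ ; 1F → legal₁ ; 2F → legal₂ ; 3F → legal₃ }) , safe₀

  -- Position n has columns 0, …, n + 1 filled in.
  position : ℕ → Σ Position Safe
  nextColumn : ∀ n → Σ[ x ∈ (Row → ℕ) ] (∀ i → Legal (2 + n) i (x i)) ×
                                        Safe (column x ++ proj₁ (position n))

  position zero    = opening x₁ , safe-opening
  position (suc n) = let x , _ , safe = nextColumn n in column x ++ proj₁ (position n) , safe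

  nextColumn n = column-step (2 + n) (proj₂ (position n))

  a : Row → ℕ → ℕ
  a i 0             = e i
  a i 1             = x₁ i
  a i (suc (suc n)) = proj₁ (nextColumn n) i

  a-legal : ∀ n i → Legal (2 + n) i (a i (2 + n))
  a-legal n = proj₁ (proj₂ (nextColumn n))

  a-avoids : ∀ i j → 2 ≤ j → a i j ≢ a i 0 × a i j ≢ a i 1
  a-avoids i 1 (s≤s ())
  a-avoids i (suc (suc n)) _ = proj₂ (a-legal n i)

  ∈-position⁺ : ∀ n {k} → k < 2 + n → (i , a i k) ∈ proj₁ (position n)
  ∈-position⁺ {i} zero {0} _ = e∈ x₁ i
  ∈-position⁺ {i} zero {1} _ = x∈ x₁ i
  ∈-position⁺ zero {suc (suc _)} (s≤s (s≤s ()))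
  ∈-position⁺ {i} (suc n) {k} k<3+n with ℕ.m<1+n⇒m<n∨m≡n k<3+n
  ... | inj₁ k<2+n = ∈-++⁺ʳ (column (proj₁ (nextColumn n))) (∈-position⁺ n k<2+n)
  ... | inj₂ refl  = ∈-column⁺ (proj₁ (nextColumn n)) (proj₁ (position n)) i

  ∈-position⁻ : ∀ n → (i , z) ∈ proj₁ (position n) → ∃[ k ] k < 2 + n × z ≡ a i k
  ∈-position⁻ zero z∈ with ∈-opening⁻ x₁ z∈
  ... | inj₁ z≡e = 0 , s≤s z≤n , z≡e
  ... | inj₂ z≡x = 1 , s≤s (s≤s z≤n) , z≡x
  ∈-position⁻ (suc n) z∈ with ∈-column⁻ (proj₁ (nextColumn n)) z∈
  ... | inj₁ z≡x = 2 + n , ℕ.≤-refl , z≡x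
  ... | inj₂ z∈′ = let k , k<2+n , eq = ∈-position⁻ n z∈′ in k , ℕ.m<n⇒m<1+n k<2+n , eq

  ∈-prefix⇒∈-position : ∀ n → z ∈ prefix (a i) (suc n) → (i , z) ∈ proj₁ (position n)
  ∈-prefix⇒∈-position {i = i} n z∈ with ∈-applyUpTo⁻ (a i) z∈
  ... | _ , k<2+n , refl = ∈-position⁺ n k<2+n

  ∈-position⇒∈-prefix : ∀ n → (i , z) ∈ proj₁ (position n) → z ∈ prefix (a i) (suc n)
  ∈-position⇒∈-prefix {i} n z∈ with ∈-position⁻ n z∈
  ... | _ , k<2+n , refl = ∈-applyUpTo⁺ (a i) k<2+n

  prefixes-differ : ∀ r s → r ≢ s → ∀ j → ¬ (prefix (a r) j ∼[ set ] prefix (a s) j)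
  -- One column alone is not yet a safe position; its values are distinct by choice of `e`.
  prefixes-differ r s r≢s zero eq with Equivalence.to eq (here refl)
  ... | here er≡es = e-distinct r≢s er≡es
  -- The prefix with index n + 1 has n + 2 entries, exactly the columns of `position n`.
  prefixes-differ r s r≢s (suc n) eq with Safe⇒separated (proj₂ (position n)) r≢s
  ... | z , inj₁ (z∈r , z∉s) =
    z∉s (∈-prefix⇒∈-position n (Equivalence.to eq (∈-position⇒∈-prefix n z∈r)))
  ... | z , inj₂ (z∈s , z∉r) =
    z∉r (∈-prefix⇒∈-position n (Equivalence.from eq (∈-position⇒∈-prefix n z∈s)))

theorem2p1 : (S : Fin 4 → ℕ → List ℕ) →
    (∀ i j → Unique (S i j)) → (∀ i j → length (S i j) ≡ 4) →
    Σ (Fin 4 → ℕ → ℕ) λ a →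
    (∀ i j → a i j ∈ S i j) ×
    (∀ i → (a i 0 ≢ a i 1 × a i 0 ≢ a i 2 × a i 1 ≢ a i 2) ×
    (∀ j → 2 ≤ j → a i j ≢ a i 0 × a i j ≢ a i 1)) ×
    (∀ r₁ r₂ → r₁ ≢ r₂ → ∀ j → ¬ (prefix (a r₁) j ∼[ set ] prefix (a r₂) j))
theorem2p1 S S! ∣S∣≡4
  with e , e∈S , e-injective ← distinctChoice ℕ._≟_ (λ i → S i 0) (λ i → S! i 0)
         (λ i → ℕ.≤-reflexive (sym (∣S∣≡4 i 0)))
  with x₁ , x₁-legal , safe ← Opening.safeOpening e e-injective
         (λ i → S i 1) (λ i → S! i 1) (λ i → ∣S∣≡4 i 1)
  = let open Play S S! ∣S∣≡4 e e-injective x₁ safe in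
  a ,
  (λ { i 0 → e∈S i ; i 1 → proj₁ (x₁-legal i) ; i (suc (suc n)) → proj₁ (a-legal n i) }) ,
  (λ i → let a₂≢a₀ , a₂≢a₁ = a-avoids i 2 ℕ.≤-refl
         in (≢-sym (proj₂ (x₁-legal i)) , ≢-sym a₂≢a₀ , ≢-sym a₂≢a₁) , a-avoids i) ,
  prefixes-differ
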